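{- Let $\mathcal P$ be the Petersen graph on the vertex set $H=\{a_1,a_2,a_3,b_1,b_2,\tilde b_3,c_2,c_3,c_4,c_5\}$ with the $15$ edges $c_4c_2,\ c_2\tilde b_3,\ \tilde b_3a_1,\ a_1c_5,\ c_5c_4$ (outer cycle), $c_4c_3,\ c_2a_3,\ \tilde b_3b_2,\ a_1a_2,\ c_5b_1$ (spokes), $c_3b_2,\ b_2b_1,\ b_1a_3,\ a_3a_2,\ a_2c_3$ (inner pentagram). Write $a\sim b$ for adjacency. In $\mathbb{Q}[\beta,\ell_b : b\in H]$ let $\mathcal I$ be the ideal generated by the ten linear forms $\ell_b-\sum_{a\sim b}\ell_a$ ($b\in H$). Put $u_b^{\pm}=\tfrac12(\ell_b\pm\beta)$, for $J\subseteq H$ put $X^J:=\prod_{b\notin J}u_b^+\prod_{b\in J}u_b^-$, and let $$F:=7X^{\emptyset}-2\sum_{b\in H}X^{\{b\}}+\sum_{\{a,b\}\text{ edge of }\mathcal P}X^{\{a,b\}}.$$ Let $C$ be the ring automorphism with $C(\ell_b)=-\ell_b$ for all $b$ and $C(\beta)=\beta$ (it preserves $\mathcal I$). Then $C(F)-F\in\mathcal I$, i.e. the image of $F$ in $\mathbb{Q}[\beta,\ell]/\mathcal I$ is invariant under $C$.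
   Context: This encodes the paper's "Jack Littlewood–Richardson polynomial" for the triple of partitions $(21,21,321)$: the ten vertices label boxes of this triple (with $\tilde b_3$ a virtual box combining $b_3\in\nu$ and $c_1,c_6\in\lambda$), $u_b^+$ is the (signed) $\alpha$-hook symbol of box $b$ chosen in a fixed reference Stanley diagram $X$ and $u_b^-$ the (signed) opposite hook, with $\beta$ a formal variable evaluating to $\alpha-1$; $F$ is the 26-term Stanley sum $7X-2\sum_b X^{\{b\}}+\sum_{\text{edges}}X^{\{a,b\}}$ written in these variables, and $\mathbb{Q}[\beta,\ell]/\mathcal I$ is the "hook space" in which it is considered. -}

module Defs where

open import Data.Nat using (ℕ; zero; suc)
open import Data.Fin using (Fin; zero; suc)
open import Data.Bool using (Bool; true; false; if_then_else_; _∧_; _∨_)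
open import Data.List using (List; []; _∷_; map; foldr; concatMap)
open import Data.Product using (_×_; _,_)
open import Data.Rational using (ℚ; 0ℚ; 1ℚ; ½) renaming (_+_ to _+ℚ_; _*_ to _*ℚ_; -_ to -ℚ_)
import Data.Rational as Q
import Data.Fin as F
open import Relation.Nullary.Decidable using (⌊_⌋)
open import Relation.Binary.PropositionalEquality using (_≡_)

-- Dense recursive (Horner) representation of ℚ[x_0,…,x_{n-1}]:
-- HP 0 = ℚ, HP (n+1) = coefficient lists (in the top variable x_n,
-- lowest degree first) over HP n.  Trailing zero coefficients are
-- allowed; polynomial equality is tested via `isZero` of the difference.

HP : ℕ → Set
HP zero    = ℚ
HP (suc n) = List (HP n)

cstP : ∀ n → ℚ → HP n
cstP zero    q = q
cstP (suc n) q = cstP n q ∷ []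

zeroP : ∀ n → HP n
zeroP n = cstP n 0ℚ

mutual
  addP : ∀ n → HP n → HP n → HP n
  addP zero    p q = p +ℚ q
  addP (suc n) p q = addL n p q

  addL : ∀ n → List (HP n) → List (HP n) → List (HP n)
  addL n []      q       = q
  addL n (a ∷ p) []      = a ∷ p
  addL n (a ∷ p) (b ∷ q) = addP n a b ∷ addL n p q

negP : ∀ n → HP n → HP n
negP zero    p = -ℚ p
negP (suc n) p = map (negP n) p

mutual
  mulP : ∀ n → HP n → HP n → HP n
  mulP zero    p q = p *ℚ q
  mulP (suc n) p q = mulL n p q

  mulL : ∀ n → List (HP n) → List (HP n) → List (HP n)
  mulL n []      q = []
  mulL n (a ∷ p) q = addL n (map (mulP n a) q) (zeroP n ∷ mulL n p q)

varP : ∀ n → Fin n → HP n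
varP (suc n) zero    = zeroP n ∷ cstP n 1ℚ ∷ []
varP (suc n) (suc i) = varP n i ∷ []

isZero : ∀ n → HP n → Bool
isZero zero    q = ⌊ q Q.≟ 0ℚ ⌋
isZero (suc n) []      = true
isZero (suc n) (a ∷ p) = isZero n a ∧ isZero (suc n) p

data Vertex : Set where
  a1 a2 a3 b1 b2 b3~ c2 c3 c4 c5 : Vertex

vertices : List Vertex
vertices = a1 ∷ a2 ∷ a3 ∷ b1 ∷ b2 ∷ b3~ ∷ c2 ∷ c3 ∷ c4 ∷ c5 ∷ []

vidx : Vertex → Fin 10
vidx a1  = zero
vidx a2  = suc zero
vidx a3  = suc (suc zero)
vidx b1  = suc (suc (suc zero))
vidx b2  = suc (suc (suc (suc zero)))
vidx b3~ = suc (suc (suc (suc (suc zero))))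
vidx c2  = suc (suc (suc (suc (suc (suc zero)))))
vidx c3  = suc (suc (suc (suc (suc (suc (suc zero))))))
vidx c4  = suc (suc (suc (suc (suc (suc (suc (suc zero)))))))
vidx c5  = suc (suc (suc (suc (suc (suc (suc (suc (suc zero))))))))

_==_ : Vertex → Vertex → Bool
u == v = ⌊ vidx u F.≟ vidx v ⌋

edges : List (Vertex × Vertex)
edges = (c4 , c2) ∷ (c2 , b3~) ∷ (b3~ , a1) ∷ (a1 , c5) ∷ (c5 , c4)   -- outer cycle
      ∷ (c4 , c3) ∷ (c2 , a3) ∷ (b3~ , b2) ∷ (a1 , a2) ∷ (c5 , b1)   -- spokes
      ∷ (c3 , b2) ∷ (b2 , b1) ∷ (b1 , a3) ∷ (a3 , a2) ∷ (a2 , c3)    -- inner pentagram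
      ∷ []

neighbours : Vertex → List Vertex
neighbours b = concatMap (λ { (x , y) →
  if x == b then y ∷ [] else (if y == b then x ∷ [] else []) }) edges

data Var : Set where
  β : Var
  ℓ : Vertex → Var

data Expr : Set where
  var  : Var → Expr
  con  : ℚ → Expr
  _⊕_  : Expr → Expr → Expr
  _⊗_  : Expr → Expr → Expr
  ⊖_   : Expr → Expr

infixl 6 _⊕_
infixl 7 _⊗_

varIdx : Var → Fin 11
varIdx β     = zero
varIdx (ℓ b) = suc (vidx b)

⟦_⟧ : Expr → HP 11
⟦ var v ⟧   = varP 11 (varIdx v)
⟦ con q ⟧   = cstP 11 q
⟦ e ⊕ f ⟧   = addP 11 ⟦ e ⟧ ⟦ f ⟧
⟦ e ⊗ f ⟧   = mulP 11 ⟦ e ⟧ ⟦ f ⟧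
⟦ ⊖ e ⟧     = negP 11 ⟦ e ⟧

_≈_ : Expr → Expr → Set
e ≈ f = isZero 11 ⟦ e ⊕ ⊖ f ⟧ ≡ true

sumE : ∀ {A : Set} → List A → (A → Expr) → Expr
sumE xs f = foldr (λ x acc → f x ⊕ acc) (con 0ℚ) xs

prodE : ∀ {A : Set} → List A → (A → Expr) → Expr
prodE xs f = foldr (λ x acc → f x ⊗ acc) (con 1ℚ) xs

gen : Vertex → Expr
gen b = var (ℓ b) ⊕ ⊖ sumE (neighbours b) (λ a → var (ℓ a))

InI : Expr → Set
InI e = Data.Product.Σ (Vertex → Expr) λ g → e ≈ sumE vertices (λ b → g b ⊗ gen b)

u⁺ u⁻ : Vertex → Expr
u⁺ b = con ½ ⊗ (var (ℓ b) ⊕ var β)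
u⁻ b = con ½ ⊗ (var (ℓ b) ⊕ ⊖ var β)

X : (Vertex → Bool) → Expr
X J = prodE vertices (λ b → if J b then u⁻ b else u⁺ b)

∅ : Vertex → Bool
∅ _ = false

F : Expr
F = con (Q._/_ (Data.Integer.+ 7) 1) ⊗ X ∅
  ⊕ ⊖ (con (1ℚ +ℚ 1ℚ) ⊗ sumE vertices (λ b → X (λ v → v == b)))
  ⊕ sumE edges (λ { (a , b) → X (λ v → (v == a) ∨ (v == b)) })
  where import Data.Integer

C : Expr → Expr
C (var β)     = var β
C (var (ℓ b)) = ⊖ var (ℓ b)
C (con q)     = con q
C (e ⊕ f)     = C e ⊕ C f
C (e ⊗ f)     = C e ⊗ C f
C (⊖ e)       = ⊖ C e

{-# OPTIONS --safe #-}
module Submission where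

-- Write y_b = ℓ_b/2 and s = β/2, so that u_b^± = y_b ± s and C acts by y ↦ -y.
-- The generators of 𝓘 at the five vertices of the outer cycle express each
-- inner y_b through outer ones: y_b = y_i - y_j - y_k, where i is the
-- outer neighbour of b, and j, k are the outer neighbours of i.  (The five inner
-- generators are then redundant.)  Substituting, C(F) = F becomes an identity
-- between integer polynomials in six variables, which is checked by computing
-- Horner normal forms.  This is sound because coefficient lists modulo
-- trailing zeros form a commutative ring, and so does its quotient by 𝓘.

open import Defs

open import Algebra.Bundles using (CommutativeRing; CommutativeSemigroup; RawRing)
import Algebra.Morphism.RingMonomorphism as RingMonomorphism
open import Algebra.Morphism.Structures using (module RingMorphisms)
import Algebra.Properties.AbelianGroup as AbelianGroupProperties
import Algebra.Properties.CommutativeSemigroup as CommutativeSemigroupProperties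
import Algebra.Properties.Ring as RingProperties
import Algebra.Solver.Ring as RingSolver
open import Algebra.Solver.Ring.AlmostCommutativeRing using (fromCommutativeRing; Induced-equivalence; _-Raw-AlmostCommutative⟶_)
open import Algebra.Structures using (IsCommutativeRing)
open import Data.Bool using (Bool; T; true; false; if_then_else_; _∨_)
open import Data.Bool.Properties using (T-≡; T-∧)
open import Data.Fin using (#_)
open import Data.Integer using (ℤ; +_)
import Data.Integer as ℤ
import Data.Integer.Properties as ℤ
open import Data.Integer.Tactic.RingSolver using (solve-∀)
open import Data.List using (List; []; _∷_; foldr; map)
import Data.Maybe as Maybe
open import Data.Maybe using (just; is-just)
open import Data.Nat using (ℕ; zero; suc)
import Data.Nat.Coprimality as Coprimality
open import Data.Product using (_,_)
open import Data.Rational using (ℚ; 0ℚ; 1ℚ; ½; -½; mkℚ) renaming (_+_ to _+ℚ_; _*_ to _*ℚ_; -_ to -ℚ_)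
import Data.Rational.Properties as ℚ
open import Data.Rational.Unnormalised using (*≡*)
import Data.Rational.Unnormalised.Properties as ℚᵘ
open import Data.Vec using (Vec; []; _∷_)
open import Function.Base using (_∘_)
open import Function.Bundles using (Equivalence)
open import Level using (0ℓ; _⊔_)
open import Relation.Binary.Bundles using (Setoid)
open import Relation.Binary.Core using (Rel)
open import Relation.Binary.Definitions using (WeaklyDecidable)
open import Relation.Binary.PropositionalEquality using (_≡_; refl; cong; sym; subst₂)
import Relation.Binary.Reasoning.Setoid as SetoidReasoning
open import Relation.Nullary.Decidable using (dec⇒maybe; toWitness; fromWitness)
open import Relation.Unary using (Pred)

-- Polynomials as coefficient lists

-- The constructors `[]∷` and `∷[]` compare surplus entries of the longer list with `0#`, so lists
-- are identified up to trailing zeros. The inductive form lets the ring laws be proved by recursion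
-- along the lists.
data PaddedPointwise {A : Set} (_∼_ : Rel A 0ℓ) (0# : A) : Rel (List A) 0ℓ where
  []  : PaddedPointwise _∼_ 0# [] []
  []∷ : ∀ {b q} → 0# ∼ b → PaddedPointwise _∼_ 0# [] q → PaddedPointwise _∼_ 0# [] (b ∷ q)
  ∷[] : ∀ {a p} → a ∼ 0# → PaddedPointwise _∼_ 0# p [] → PaddedPointwise _∼_ 0# (a ∷ p) []
  _∷_ : ∀ {a b p q} → a ∼ b → PaddedPointwise _∼_ 0# p q → PaddedPointwise _∼_ 0# (a ∷ p) (b ∷ q)

EqP : ∀ n → Rel (HP n) 0ℓ
EqP zero    = _≡_
EqP (suc n) = PaddedPointwise (EqP n) (zeroP n)

IsCommutativeRingP : ℕ → Set
IsCommutativeRingP n = IsCommutativeRing (EqP n) (addP n) (mulP n) (negP n) (zeroP n) (cstP n 1ℚ)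

module CoefficientLists (n : ℕ) (isCommutativeRing : IsCommutativeRingP n) where

  private
    R : CommutativeRing 0ℓ 0ℓ
    R = record { isCommutativeRing = isCommutativeRing }
    module R = CommutativeRing R
    module RP = RingProperties R.ring
    open R using (Carrier; _+_; _*_; -_; 0#; 1#)

  infix  4 _≋_
  infixl 6 _+ₗ_
  infixl 7 _*ₗ_ _·_

  _≋_ : Rel (List Carrier) 0ℓ
  _≋_ = EqP (suc n)

  _+ₗ_ _*ₗ_ : List Carrier → List Carrier → List Carrier
  _+ₗ_ = addL n
  _*ₗ_ = mulL n

  -ₗ_ : List Carrier → List Carrier
  -ₗ_ = negP (suc n)

  _·_ : Carrier → List Carrier → List Carrier
  a · p = map (mulP n a) p

  ≋-refl : ∀ {p} → p ≋ p
  ≋-refl {[]}    = []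
  ≋-refl {a ∷ p} = R.refl ∷ ≋-refl

  ≋-sym : ∀ {p q} → p ≋ q → q ≋ p
  ≋-sym []        = []
  ≋-sym ([]∷ e s) = ∷[] (R.sym e) (≋-sym s)
  ≋-sym (∷[] e s) = []∷ (R.sym e) (≋-sym s)
  ≋-sym (e ∷ s)   = R.sym e ∷ ≋-sym s

  ≋-trans : ∀ {p q r} → p ≋ q → q ≋ r → p ≋ r
  ≋-trans []        t          = t
  ≋-trans ([]∷ e s) (∷[] e′ t) = []
  ≋-trans ([]∷ e s) (e′ ∷ t)   = []∷ (R.trans e e′) (≋-trans s t)
  ≋-trans (∷[] e s) []         = ∷[] e s
  ≋-trans (∷[] e s) ([]∷ e′ t) = R.trans e e′ ∷ ≋-trans s t
  ≋-trans (e ∷ s)   (∷[] e′ t) = ∷[] (R.trans e e′) (≋-trans s t)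
  ≋-trans (e ∷ s)   (e′ ∷ t)   = R.trans e e′ ∷ ≋-trans s t

  ≋-setoid : Setoid 0ℓ 0ℓ
  ≋-setoid = record
    { _≈_ = _≋_
    ; isEquivalence = record { refl = ≋-refl ; sym = ≋-sym ; trans = ≋-trans }
    }

  open SetoidReasoning ≋-setoid

  -- Two representatives of zero meet here: `zeroP (suc n)` is the one-entry list, while the
  -- recursions of `addL` and `mulL` end in `[]`.
  0∷[]≋[] : 0# ∷ [] ≋ []
  0∷[]≋[] = ∷[] R.refl []

  +ₗ-comm : ∀ p q → p +ₗ q ≋ q +ₗ p
  +ₗ-comm []      []      = []
  +ₗ-comm []      (b ∷ q) = ≋-refl
  +ₗ-comm (a ∷ p) []      = ≋-refl
  +ₗ-comm (a ∷ p) (b ∷ q) = R.+-comm a b ∷ +ₗ-comm p q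

  -- One side suffices: commutativity holds entry by entry and transfers congruence to the other
  -- argument.
  +ₗ-congʳ : ∀ {p p′} q → p ≋ p′ → p +ₗ q ≋ p′ +ₗ q
  +ₗ-congʳ q       []        = ≋-refl
  +ₗ-congʳ []      ([]∷ e s) = []∷ e s
  +ₗ-congʳ (c ∷ q) ([]∷ e s) = R.trans (R.sym (R.+-identityˡ c)) (R.+-congʳ e) ∷ +ₗ-congʳ q s
  +ₗ-congʳ []      (∷[] e s) = ∷[] e s
  +ₗ-congʳ (c ∷ q) (∷[] e s) = R.trans (R.+-congʳ e) (R.+-identityˡ c) ∷ +ₗ-congʳ q s
  +ₗ-congʳ []      (e ∷ s)   = e ∷ s
  +ₗ-congʳ (c ∷ q) (e ∷ s)   = R.+-congʳ e ∷ +ₗ-congʳ q s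

  +ₗ-cong : ∀ {p p′ q q′} → p ≋ p′ → q ≋ q′ → p +ₗ q ≋ p′ +ₗ q′
  +ₗ-cong {p} {p′} {q} {q′} s t = begin
    p +ₗ q    ≈⟨ +ₗ-congʳ q s ⟩
    p′ +ₗ q   ≈⟨ +ₗ-comm p′ q ⟩
    q +ₗ p′   ≈⟨ +ₗ-congʳ p′ t ⟩
    q′ +ₗ p′  ≈⟨ +ₗ-comm q′ p′ ⟩
    p′ +ₗ q′  ∎

  +ₗ-assoc : ∀ p q r → (p +ₗ q) +ₗ r ≋ p +ₗ (q +ₗ r)
  +ₗ-assoc []      q       r       = ≋-refl
  +ₗ-assoc (a ∷ p) []      r       = ≋-refl
  +ₗ-assoc (a ∷ p) (b ∷ q) []      = ≋-refl
  +ₗ-assoc (a ∷ p) (b ∷ q) (c ∷ r) = R.+-assoc a b c ∷ +ₗ-assoc p q r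

  +ₗ-identityʳ : ∀ p → p +ₗ [] ≋ p
  +ₗ-identityʳ p = +ₗ-comm p []

  +ₗ-commutativeSemigroup : CommutativeSemigroup 0ℓ 0ℓ
  +ₗ-commutativeSemigroup = record
    { isCommutativeSemigroup = record
      { isSemigroup = record
        { isMagma = record { isEquivalence = Setoid.isEquivalence ≋-setoid ; ∙-cong = +ₗ-cong }
        ; assoc   = +ₗ-assoc
        }
      ; comm = +ₗ-comm
      }
    }

  open CommutativeSemigroupProperties +ₗ-commutativeSemigroup using (interchange; x∙yz≈y∙xz)

  -ₗ-cong : ∀ {p q} → p ≋ q → -ₗ p ≋ -ₗ q
  -ₗ-cong []        = []
  -ₗ-cong ([]∷ e s) = []∷ (R.trans (R.sym RP.-0#≈0#) (R.-‿cong e)) (-ₗ-cong s)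
  -ₗ-cong (∷[] e s) = ∷[] (R.trans (R.-‿cong e) RP.-0#≈0#) (-ₗ-cong s)
  -ₗ-cong (e ∷ s)   = R.-‿cong e ∷ -ₗ-cong s

  -ₗ-inverseˡ : ∀ p → -ₗ p +ₗ p ≋ []
  -ₗ-inverseˡ []      = []
  -ₗ-inverseˡ (a ∷ p) = ∷[] (R.-‿inverseˡ a) (-ₗ-inverseˡ p)

  ·-cong : ∀ {a b p q} → a R.≈ b → p ≋ q → a · p ≋ b · q
  ·-cong e []        = []
  ·-cong {b = b} e ([]∷ f s) = []∷ (R.trans (R.sym (R.zeroʳ b)) (R.*-congˡ f)) (·-cong e s)
  ·-cong {a}     e (∷[] f s) = ∷[] (R.trans (R.*-congˡ f) (R.zeroʳ a)) (·-cong e s)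
  ·-cong e (f ∷ s)   = R.*-cong e f ∷ ·-cong e s

  ·-distribˡ : ∀ a p q → a · (p +ₗ q) ≋ a · p +ₗ a · q
  ·-distribˡ a []      q       = ≋-refl
  ·-distribˡ a (b ∷ p) []      = ≋-refl
  ·-distribˡ a (b ∷ p) (c ∷ q) = R.distribˡ a b c ∷ ·-distribˡ a p q

  ·-distribʳ : ∀ p a b → (a + b) · p ≋ a · p +ₗ b · p
  ·-distribʳ []      a b = []
  ·-distribʳ (c ∷ p) a b = R.distribʳ c a b ∷ ·-distribʳ p a b

  ·-assoc : ∀ a b p → (a * b) · p ≋ a · (b · p)
  ·-assoc a b []      = []
  ·-assoc a b (c ∷ p) = R.*-assoc a b c ∷ ·-assoc a b p

  ·-zeroˡ : ∀ p → 0# · p ≋ []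
  ·-zeroˡ []      = []
  ·-zeroˡ (a ∷ p) = ∷[] (R.zeroˡ a) (·-zeroˡ p)

  ·-identityˡ : ∀ p → 1# · p ≋ p
  ·-identityˡ []      = []
  ·-identityˡ (a ∷ p) = R.*-identityˡ a ∷ ·-identityˡ p

  *ₗ-congˡ : ∀ p {q q′} → q ≋ q′ → p *ₗ q ≋ p *ₗ q′
  *ₗ-congˡ []      s = []
  *ₗ-congˡ (a ∷ p) s = +ₗ-cong (·-cong R.refl s) (R.refl ∷ *ₗ-congˡ p s)

  *ₗ-zeroʳ : ∀ p → p *ₗ [] ≋ []
  *ₗ-zeroʳ []      = []
  *ₗ-zeroʳ (a ∷ p) = ∷[] R.refl (*ₗ-zeroʳ p)

  -- `mulL` recurses on its left factor; this is the matching recursion on the right factor, from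
  -- which commutativity follows by induction.
  *ₗ-∷ʳ : ∀ p b q → p *ₗ (b ∷ q) ≋ b · p +ₗ (0# ∷ p *ₗ q)
  *ₗ-∷ʳ []      b q = []∷ R.refl []
  *ₗ-∷ʳ (a ∷ p) b q = R.+-congʳ (R.*-comm a b) ∷ (begin
    a · q +ₗ p *ₗ (b ∷ q)               ≈⟨ +ₗ-cong ≋-refl (*ₗ-∷ʳ p b q) ⟩
    a · q +ₗ (b · p +ₗ (0# ∷ p *ₗ q))   ≈⟨ x∙yz≈y∙xz (a · q) (b · p) _ ⟩
    b · p +ₗ (a · q +ₗ (0# ∷ p *ₗ q))   ∎)

  *ₗ-comm : ∀ p q → p *ₗ q ≋ q *ₗ p
  *ₗ-comm []      q = ≋-sym (*ₗ-zeroʳ q)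
  *ₗ-comm (a ∷ p) q = begin
    a · q +ₗ (0# ∷ p *ₗ q)  ≈⟨ +ₗ-cong ≋-refl (R.refl ∷ *ₗ-comm p q) ⟩
    a · q +ₗ (0# ∷ q *ₗ p)  ≈⟨ *ₗ-∷ʳ q a p ⟨
    q *ₗ (a ∷ p)            ∎

  *ₗ-cong : ∀ {p p′ q q′} → p ≋ p′ → q ≋ q′ → p *ₗ q ≋ p′ *ₗ q′
  *ₗ-cong {p} {p′} {q} {q′} s t = begin
    p *ₗ q    ≈⟨ *ₗ-congˡ p t ⟩
    p *ₗ q′   ≈⟨ *ₗ-comm p q′ ⟩
    q′ *ₗ p   ≈⟨ *ₗ-congˡ q′ s ⟩
    q′ *ₗ p′  ≈⟨ *ₗ-comm q′ p′ ⟩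
    p′ *ₗ q′  ∎

  *ₗ-distribʳ : ∀ r p q → (p +ₗ q) *ₗ r ≋ p *ₗ r +ₗ q *ₗ r
  *ₗ-distribʳ r []      q       = ≋-refl
  *ₗ-distribʳ r (a ∷ p) []      = ≋-sym (+ₗ-identityʳ _)
  *ₗ-distribʳ r (a ∷ p) (b ∷ q) = begin
    (a + b) · r +ₗ (0# ∷ (p +ₗ q) *ₗ r)
      ≈⟨ +ₗ-cong (·-distribʳ r a b) (R.sym (R.+-identityˡ 0#) ∷ *ₗ-distribʳ r p q) ⟩
    (a · r +ₗ b · r) +ₗ ((0# ∷ p *ₗ r) +ₗ (0# ∷ q *ₗ r))
      ≈⟨ interchange (a · r) (b · r) _ _ ⟩
    (a ∷ p) *ₗ r +ₗ (b ∷ q) *ₗ r ∎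

  *ₗ-distribˡ : ∀ r p q → r *ₗ (p +ₗ q) ≋ r *ₗ p +ₗ r *ₗ q
  *ₗ-distribˡ r p q = begin
    r *ₗ (p +ₗ q)      ≈⟨ *ₗ-comm r (p +ₗ q) ⟩
    (p +ₗ q) *ₗ r      ≈⟨ *ₗ-distribʳ r p q ⟩
    p *ₗ r +ₗ q *ₗ r   ≈⟨ +ₗ-cong (*ₗ-comm p r) (*ₗ-comm q r) ⟩
    r *ₗ p +ₗ r *ₗ q   ∎

  ·-*ₗ-assoc : ∀ a p q → (a · p) *ₗ q ≋ a · (p *ₗ q)
  ·-*ₗ-assoc a []      q = []
  ·-*ₗ-assoc a (b ∷ p) q = begin
    (a * b) · q +ₗ (0# ∷ (a · p) *ₗ q)
      ≈⟨ +ₗ-cong (·-assoc a b q) (R.sym (R.zeroʳ a) ∷ ·-*ₗ-assoc a p q) ⟩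
    a · (b · q) +ₗ a · (0# ∷ p *ₗ q)
      ≈⟨ ·-distribˡ a (b · q) (0# ∷ p *ₗ q) ⟨
    a · ((b ∷ p) *ₗ q) ∎

  -- Prefixing `0#` is multiplication by the top variable, and associativity needs this shift moved
  -- out of the product. The extra summand `0# · q` consists of zeros.
  0∷-*ₗ : ∀ p q → (0# ∷ p) *ₗ q ≋ 0# ∷ p *ₗ q
  0∷-*ₗ p q = +ₗ-congʳ (0# ∷ p *ₗ q) (·-zeroˡ q)

  *ₗ-assoc : ∀ p q r → (p *ₗ q) *ₗ r ≋ p *ₗ (q *ₗ r)
  *ₗ-assoc []      q r = []
  *ₗ-assoc (a ∷ p) q r = begin
    (a · q +ₗ (0# ∷ p *ₗ q)) *ₗ r
      ≈⟨ *ₗ-distribʳ r (a · q) (0# ∷ p *ₗ q) ⟩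
    (a · q) *ₗ r +ₗ (0# ∷ p *ₗ q) *ₗ r
      ≈⟨ +ₗ-cong (·-*ₗ-assoc a q r) (0∷-*ₗ (p *ₗ q) r) ⟩
    a · (q *ₗ r) +ₗ (0# ∷ (p *ₗ q) *ₗ r)
      ≈⟨ +ₗ-cong ≋-refl (R.refl ∷ *ₗ-assoc p q r) ⟩
    (a ∷ p) *ₗ (q *ₗ r) ∎

  +ₗ-identityˡ : ∀ p → (0# ∷ []) +ₗ p ≋ p
  +ₗ-identityˡ p = +ₗ-congʳ p 0∷[]≋[]

  *ₗ-identityˡ : ∀ p → (1# ∷ []) *ₗ p ≋ p
  *ₗ-identityˡ p = begin
    1# · p +ₗ (0# ∷ [])  ≈⟨ +ₗ-cong (·-identityˡ p) 0∷[]≋[] ⟩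
    p +ₗ []              ≈⟨ +ₗ-identityʳ p ⟩
    p                    ∎

  isCommutativeRingₗ : IsCommutativeRingP (suc n)
  isCommutativeRingₗ = record
    { isRing = record
      { +-isAbelianGroup = record
        { isGroup = record
          { isMonoid = record
            { isSemigroup = CommutativeSemigroup.isSemigroup +ₗ-commutativeSemigroup
            ; identity    = +ₗ-identityˡ
                          , λ p → ≋-trans (+ₗ-comm p (0# ∷ [])) (+ₗ-identityˡ p)
            }
          ; inverse = inverseˡ , λ p → ≋-trans (+ₗ-comm p (-ₗ p)) (inverseˡ p)
          ; ⁻¹-cong = -ₗ-cong
          }
        ; comm = +ₗ-comm
        }
      ; *-cong     = *ₗ-cong
      ; *-assoc    = *ₗ-assoc
      ; *-identity = *ₗ-identityˡ , λ p → ≋-trans (*ₗ-comm p (1# ∷ [])) (*ₗ-identityˡ p)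
      ; distrib    = *ₗ-distribˡ , *ₗ-distribʳ
      }
    ; *-comm = *ₗ-comm
    }
    where
    inverseˡ : ∀ p → -ₗ p +ₗ p ≋ 0# ∷ []
    inverseˡ p = ≋-trans (-ₗ-inverseˡ p) (≋-sym 0∷[]≋[])

isCommutativeRingP : ∀ n → IsCommutativeRingP n
isCommutativeRingP zero    = ℚ.+-*-isCommutativeRing
isCommutativeRingP (suc n) = CoefficientLists.isCommutativeRingₗ n (isCommutativeRingP n)

commutativeRingP : ℕ → CommutativeRing 0ℓ 0ℓ
commutativeRingP n = record { isCommutativeRing = isCommutativeRingP n }

-- Constants and the zero test

EqP-refl : ∀ n {p} → EqP n p p
EqP-refl n = CommutativeRing.refl (commutativeRingP n)

cstP-+ : ∀ n p q → EqP n (cstP n (p +ℚ q)) (addP n (cstP n p) (cstP n q))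
cstP-+ zero    p q = refl
cstP-+ (suc n) p q = cstP-+ n p q ∷ []

cstP-* : ∀ n p q → EqP n (cstP n (p *ℚ q)) (mulP n (cstP n p) (cstP n q))
cstP-* zero    p q = refl
cstP-* (suc n) p q = R.trans (cstP-* n p q) (R.sym (R.+-identityʳ _)) ∷ []
  where module R = CommutativeRing (commutativeRingP n)

cstP-neg : ∀ n p → EqP n (cstP n (-ℚ p)) (negP n (cstP n p))
cstP-neg zero    p = refl
cstP-neg (suc n) p = cstP-neg n p ∷ []

isZero-sound : ∀ n p → T (isZero n p) → EqP n p (zeroP n)
isZero-sound zero    p       t = toWitness t
isZero-sound (suc n) []      t = []∷ (EqP-refl n) []
isZero-sound (suc n) (a ∷ p) t with Equivalence.to T-∧ t
... | ta , tp with isZero-sound (suc n) p tp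
-- The recursive result relates `p` to the one-entry list `zeroP (suc n)`, but as a tail `p` must be
-- related to `[]`: either `p` is empty, or its head becomes a surplus entry.
...   | []∷ _ _ = isZero-sound n a ta ∷ []
...   | e ∷ s   = isZero-sound n a ta ∷ ∷[] e s

-- Membership in `InI` is witnessed by the Boolean test, so equations derived from ring laws must be
-- turned back into a successful test.
isZero-complete : ∀ n p → EqP n p (zeroP n) → T (isZero n p)
isZero-complete zero    p       e         = fromWitness e
isZero-complete (suc n) []      e         = _
isZero-complete (suc n) (a ∷ p) (e ∷ s)   =
  Equivalence.from T-∧
    ( isZero-complete n a e
    , isZero-complete (suc n) p (CommutativeRing.trans (commutativeRingP (suc n)) s ([]∷ (EqP-refl n) []))
    )

-- Quotient rings

record IsIdeal {c ℓ i} (R : CommutativeRing c ℓ) (I : Pred (CommutativeRing.Carrier R) i) : Set (c ⊔ ℓ ⊔ i) where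
  open CommutativeRing R renaming (_≈_ to _≈ᴿ_)
  field
    I-resp-≈ : ∀ {x y} → x ≈ᴿ y → I x → I y
    I-0      : I 0#
    I-+      : ∀ {x y} → I x → I y → I (x + y)
    I-*      : ∀ x {y} → I y → I (x * y)

module Quotient {c ℓ i} (R : CommutativeRing c ℓ)
  (I : Pred (CommutativeRing.Carrier R) i) (isIdeal : IsIdeal R I) where

  open CommutativeRing R using (Carrier; _+_; _*_; _-_; -_; 0#; 1#) renaming (_≈_ to _≈ᴿ_)
  open IsIdeal isIdeal

  private
    module R = CommutativeRing R
    open RingProperties R.ring using (-1*x≈-x; x[y-z]≈xy-xz)
    open AbelianGroupProperties R.+-abelianGroup using (⁻¹-anti-homo‿-; ⁻¹-∙-comm)
    open CommutativeSemigroupProperties R.+-commutativeSemigroup using (interchange)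
    open SetoidReasoning R.setoid

  -- A record keeps `x` and `y` inferable after `I` is instantiated by a predicate that unfolds.
  record _∼_ (x y : Carrier) : Set i where
    constructor congruent
    field difference : I (x - y)

  I-neg : ∀ {x} → I x → I (- x)
  I-neg {x} x∈I = I-resp-≈ (-1*x≈-x x) (I-* (- 1#) x∈I)

  telescope : ∀ x y z → (x - y) + (y - z) ≈ᴿ x - z
  telescope x y z = begin
    (x - y) + (y - z)    ≈⟨ R.+-assoc x (- y) (y - z) ⟩
    x + (- y + (y - z))  ≈⟨ R.+-congˡ (R.+-assoc (- y) y (- z)) ⟨
    x + ((- y + y) - z)  ≈⟨ R.+-congˡ (R.+-congʳ (R.-‿inverseˡ y)) ⟩
    x + (0# - z)         ≈⟨ R.+-congˡ (R.+-identityˡ (- z)) ⟩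
    x - z                ∎

  ≈⇒∼ : ∀ {x y} → x ≈ᴿ y → x ∼ y
  ≈⇒∼ {x} {y} x≈y = congruent
    (I-resp-≈ (R.trans (R.sym (R.-‿inverseʳ y)) (R.+-congʳ (R.sym x≈y))) I-0)

  ∼-sym : ∀ {x y} → x ∼ y → y ∼ x
  ∼-sym {x} {y} (congruent p) = congruent (I-resp-≈ (⁻¹-anti-homo‿- x y) (I-neg p))

  ∼-trans : ∀ {x y z} → x ∼ y → y ∼ z → x ∼ z
  ∼-trans {x} {y} {z} (congruent p) (congruent q) = congruent (I-resp-≈ (telescope x y z) (I-+ p q))

  +-cong-∼ : ∀ {x x′ y y′} → x ∼ x′ → y ∼ y′ → (x + y) ∼ (x′ + y′)
  +-cong-∼ {x} {x′} {y} {y′} (congruent p) (congruent q) = congruent (I-resp-≈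
    (R.trans (interchange x (- x′) y (- y′)) (R.+-congˡ (⁻¹-∙-comm x′ y′))) (I-+ p q))

  *-congˡ-∼ : ∀ x {y y′} → y ∼ y′ → (x * y) ∼ (x * y′)
  *-congˡ-∼ x {y} {y′} (congruent p) = congruent (I-resp-≈ (x[y-z]≈xy-xz x y y′) (I-* x p))

  *-cong-∼ : ∀ {x x′ y y′} → x ∼ x′ → y ∼ y′ → (x * y) ∼ (x′ * y′)
  *-cong-∼ {x} {x′} {y} {y′} p q =
    -- Pass through `x * y′`, changing one factor at a time.
    ∼-trans (*-congˡ-∼ x q)
    (∼-trans (≈⇒∼ (R.*-comm x y′))
    (∼-trans (*-congˡ-∼ y′ p) (≈⇒∼ (R.*-comm y′ x′))))

  neg-cong-∼ : ∀ {x y} → x ∼ y → (- x) ∼ (- y)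
  neg-cong-∼ {x} {y} (congruent p) =
    congruent (I-resp-≈ (R.sym (⁻¹-∙-comm x (- y))) (I-neg p))

  -- Abstract, since bundles containing this proof get compared by conversion,
  -- which must not unfold it.
  abstract
    isCommutativeRing-∼ : IsCommutativeRing _∼_ _+_ _*_ -_ 0# 1#
    isCommutativeRing-∼ = record
      { isRing = record
        { +-isAbelianGroup = record
          { isGroup = record
            { isMonoid = record
              { isSemigroup = record
                { isMagma = record
                  { isEquivalence = record { refl = ≈⇒∼ R.refl ; sym = ∼-sym ; trans = ∼-trans }
                  ; ∙-cong        = +-cong-∼
                  }
                ; assoc = λ x y z → ≈⇒∼ (R.+-assoc x y z)
                }
              ; identity = (λ x → ≈⇒∼ (R.+-identityˡ x)) , (λ x → ≈⇒∼ (R.+-identityʳ x))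
              }
            ; inverse = (λ x → ≈⇒∼ (R.-‿inverseˡ x)) , (λ x → ≈⇒∼ (R.-‿inverseʳ x))
            ; ⁻¹-cong = neg-cong-∼
            }
          ; comm = λ x y → ≈⇒∼ (R.+-comm x y)
          }
        ; *-cong     = *-cong-∼
        ; *-assoc    = λ x y z → ≈⇒∼ (R.*-assoc x y z)
        ; *-identity = (λ x → ≈⇒∼ (R.*-identityˡ x)) , (λ x → ≈⇒∼ (R.*-identityʳ x))
        ; distrib    = (λ x y z → ≈⇒∼ (R.distribˡ x y z)) , (λ x y z → ≈⇒∼ (R.distribʳ x y z))
        }
      ; *-comm = λ x y → ≈⇒∼ (R.*-comm x y)
      }

  commutativeRing : CommutativeRing c i
  commutativeRing = record { isCommutativeRing = isCommutativeRing-∼ }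

-- The identity on the Petersen graph

-- Abstracting the operations gives one shape with three instances: expressions, where it is `F`
-- itself; solver polynomials; and elements of an arbitrary commutative ring. The arguments `p` and
-- `m` play the roles of `u⁺` and `u⁻`.
module StanleySum {a} {A : Set a} (_+_ _*_ : A → A → A) (-_ : A → A) (κ : ℤ → A) where

  product : (p m : Vertex → A) → (Vertex → Bool) → A
  product p m J = foldr (λ b acc → (if J b then m b else p b) * acc) (κ (+ 1)) vertices

  stanleySum : (p m : Vertex → A) → A
  stanleySum p m =
    ((κ (+ 7) * product p m ∅)
      + (- (κ (+ 2) * foldr (λ b acc → product p m (λ v → v == b) + acc) (κ (+ 0)) vertices)))
      + foldr (λ { (a , b) acc → product p m (λ v → (v == a) ∨ (v == b)) + acc }) (κ (+ 0)) edges

ℤ-rawRing : RawRing 0ℓ 0ℓ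
ℤ-rawRing = CommutativeRing.rawRing ℤ.+-*-commutativeRing

module PetersenIdentity {c ℓ} (R : CommutativeRing c ℓ)
  (κ-morphism : ℤ-rawRing -Raw-AlmostCommutative⟶ fromCommutativeRing R) where

  open CommutativeRing R renaming (_≈_ to _≈ᴿ_; refl to ≈-refl; sym to ≈-sym; trans to ≈-trans)
  open _-Raw-AlmostCommutative⟶_ κ-morphism using () renaming (⟦_⟧ to κ)
  open StanleySum _+_ _*_ -_ κ

  -- Coefficients are compared as integers before `κ` is applied, so the comparison computes
  -- whatever the ring `R` is.
  κ-≟ : WeaklyDecidable (Induced-equivalence κ-morphism)
  κ-≟ i j = Maybe.map (λ i≡j → reflexive (cong κ i≡j)) (dec⇒maybe (i ℤ.≟ j))

  module Solver = RingSolver ℤ-rawRing (fromCommutativeRing R) κ-morphism κ-≟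
  open Solver using (Polynomial; _:+_; _:*_; _:-_; :-_; normalise; _≟N_; correct; ⟦_⟧N-cong)
    renaming (⟦_⟧ to ⟦_⟧ₛ)
  open StanleySum {A = Polynomial 6} _:+_ _:*_ :-_ Solver.con using () renaming (stanleySum to stanleySumₛ)

  -- Proof by reflection: for closed polynomials the hypothesis evaluates to the unit type when the
  -- normal forms agree, and can then be filled by `_`.
  equalNormalForms⇒≈ : ∀ {n} (p q : Polynomial n) ρ →
    T (is-just (normalise p ≟N normalise q)) → ⟦ p ⟧ₛ ρ ≈ᴿ ⟦ q ⟧ₛ ρ
  equalNormalForms⇒≈ p q ρ t with normalise p ≟N normalise q
  ... | just p≈q = ≈-trans (≈-sym (correct p ρ)) (≈-trans (⟦ p≈q ⟧N-cong ρ) (correct q ρ))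

  foldr-cong-≈ : ∀ {a} {A : Set a} (_∙_ : Carrier → Carrier → Carrier) →
    (∀ {x x′ y y′} → x ≈ᴿ x′ → y ≈ᴿ y′ → (x ∙ y) ≈ᴿ (x′ ∙ y′)) →
    ∀ (xs : List A) {f g : A → Carrier} {e} → (∀ x → f x ≈ᴿ g x) →
    foldr (λ x acc → f x ∙ acc) e xs ≈ᴿ foldr (λ x acc → g x ∙ acc) e xs
  foldr-cong-≈ _∙_ ∙-cong []       f≈g = ≈-refl
  foldr-cong-≈ _∙_ ∙-cong (x ∷ xs) f≈g = ∙-cong (f≈g x) (foldr-cong-≈ _∙_ ∙-cong xs f≈g)

  module _ (p p′ m m′ : Vertex → Carrier) (p≈p′ : ∀ v → p v ≈ᴿ p′ v) (m≈m′ : ∀ v → m v ≈ᴿ m′ v) where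

    product-cong : ∀ J → product p m J ≈ᴿ product p′ m′ J
    product-cong J = foldr-cong-≈ _*_ *-cong vertices factor-cong
      where
      factor-cong : ∀ b → (if J b then m b else p b) ≈ᴿ (if J b then m′ b else p′ b)
      factor-cong b with J b
      ... | true  = m≈m′ b
      ... | false = p≈p′ b

    stanleySum-cong : stanleySum p m ≈ᴿ stanleySum p′ m′
    stanleySum-cong =
      +-cong (+-cong (*-congˡ (product-cong ∅))
        (-‿cong (*-congˡ (foldr-cong-≈ _+_ +-cong vertices (λ b → product-cong (λ v → v == b))))))
        (foldr-cong-≈ _+_ +-cong edges (λ { (a , b) → product-cong (λ v → (v == a) ∨ (v == b)) }))

  -- The numbering of the variables is that of `ρ` below: first the half of `β`, then the vertices
  -- in the order of the outer cycle.
  t : Polynomial 6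
  t = Solver.var (# 0)

  x : Vertex → Polynomial 6
  x c4  = Solver.var (# 1)
  x c2  = Solver.var (# 2)
  x b3~ = Solver.var (# 3)
  x a1  = Solver.var (# 4)
  x c5  = Solver.var (# 5)
  x c3  = x c4 :- x c2 :- x c5
  x a3  = x c2 :- x c4 :- x b3~
  x b2  = x b3~ :- x c2 :- x a1
  x a2  = x a1 :- x b3~ :- x c5
  x b1  = x c5 :- x a1 :- x c4

  -- Evaluation suffices because the folds run over closed lists and every test of a vertex is on
  -- concrete vertices.
  ⟦stanleySumₛ⟧ : ∀ f g ρ → ⟦ stanleySumₛ f g ⟧ₛ ρ ≡ stanleySum (λ v → ⟦ f v ⟧ₛ ρ) (λ v → ⟦ g v ⟧ₛ ρ)
  ⟦stanleySumₛ⟧ f g ρ = refl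

  p m Cp Cm : Vertex → Polynomial 6
  p v  = x v :+ t
  m v  = x v :- t
  Cp v = :- x v :+ t
  Cm v = :- x v :- t

  -- The computational core: on each side 26 products of ten linear factors are expanded and the
  -- normal forms compared.
  stanleySumₛ-even : ∀ ρ → ⟦ stanleySumₛ Cp Cm ⟧ₛ ρ ≈ᴿ ⟦ stanleySumₛ p m ⟧ₛ ρ
  stanleySumₛ-even ρ = equalNormalForms⇒≈ (stanleySumₛ Cp Cm) (stanleySumₛ p m) ρ _

  module _ (y : Vertex → Carrier) (s : Carrier)
    (y-c3 : y c3 ≈ᴿ y c4 - y c2 - y c5)
    (y-a3 : y a3 ≈ᴿ y c2 - y c4 - y b3~)
    (y-b2 : y b2 ≈ᴿ y b3~ - y c2 - y a1)
    (y-a2 : y a2 ≈ᴿ y a1 - y b3~ - y c5)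
    (y-b1 : y b1 ≈ᴿ y c5 - y a1 - y c4)
    where

    ρ : Vec Carrier 6
    ρ = s ∷ y c4 ∷ y c2 ∷ y b3~ ∷ y a1 ∷ y c5 ∷ []

    y≈x : ∀ v → y v ≈ᴿ ⟦ x v ⟧ₛ ρ
    y≈x c4  = ≈-refl
    y≈x c2  = ≈-refl
    y≈x b3~ = ≈-refl
    y≈x a1  = ≈-refl
    y≈x c5  = ≈-refl
    y≈x c3  = y-c3
    y≈x a3  = y-a3
    y≈x b2  = y-b2
    y≈x a2  = y-a2
    y≈x b1  = y-b1

    -- The inner values agree with the substituted linear forms only up to the equality of `R`, so
    -- congruence carries both sums to evaluated polynomials, where `stanleySumₛ-even` applies.
    stanleySum-even : stanleySum (λ v → - y v + s) (λ v → - y v - s)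
                   ≈ᴿ stanleySum (λ v → y v + s) (λ v → y v - s)
    stanleySum-even = begin
      stanleySum (λ v → - y v + s) (λ v → - y v - s)
        ≈⟨ stanleySum-cong (λ v → - y v + s) (eval Cp) (λ v → - y v - s) (eval Cm)
             (λ v → +-congʳ (-‿cong (y≈x v))) (λ v → +-congʳ (-‿cong (y≈x v))) ⟩
      stanleySum (eval Cp) (eval Cm)
        ≡⟨ ⟦stanleySumₛ⟧ Cp Cm ρ ⟨
      ⟦ stanleySumₛ Cp Cm ⟧ₛ ρ
        ≈⟨ stanleySumₛ-even ρ ⟩
      ⟦ stanleySumₛ p m ⟧ₛ ρ
        ≡⟨ ⟦stanleySumₛ⟧ p m ρ ⟩
      stanleySum (eval p) (eval m)
        ≈⟨ stanleySum-cong (λ v → y v + s) (eval p) (λ v → y v - s) (eval m)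
             (λ v → +-congʳ (y≈x v)) (λ v → +-congʳ (y≈x v)) ⟨
      stanleySum (λ v → y v + s) (λ v → y v - s) ∎
      where
      open SetoidReasoning setoid
      eval : (Vertex → Polynomial 6) → Vertex → Carrier
      eval f v = ⟦ f v ⟧ₛ ρ

-- The hook space

-- A record, so that e and f can be inferred from a proof of e ≃ f.
record _≃_ (e f : Expr) : Set where
  constructor equal
  field values : EqP 11 ⟦ e ⟧ ⟦ f ⟧

open _≃_

-- The ring laws are pulled back along `⟦_⟧`, which respects the operations by definition;
-- injectivity is the meaning of `_≃_`. Reasoning thus stays with expressions, on which `C` and `F`
-- are defined.
exprRing : CommutativeRing 0ℓ 0ℓ
exprRing = record
  { isCommutativeRing = RingMonomorphism.isCommutativeRing ⟦⟧-isRingMonomorphism (isCommutativeRingP 11) }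
  where
  module H = CommutativeRing (commutativeRingP 11)

  rawExpr : RawRing 0ℓ 0ℓ
  rawExpr = record { _≈_ = _≃_ ; _+_ = _⊕_ ; _*_ = _⊗_ ; -_ = ⊖_ ; 0# = con 0ℚ ; 1# = con 1ℚ }

  open RingMorphisms rawExpr H.rawRing

  ⟦⟧-isRingMonomorphism : IsRingMonomorphism ⟦_⟧
  ⟦⟧-isRingMonomorphism = record
    { isRingHomomorphism = record
      { isSemiringHomomorphism = record
        { isNearSemiringHomomorphism = record
          { +-isMonoidHomomorphism = record
            { isMagmaHomomorphism = record
              { isRelHomomorphism = record { cong = values }
              ; homo = λ _ _ → H.refl
              }
            ; ε-homo = H.refl
            }
          ; *-homo = λ _ _ → H.refl
          }
        ; 1#-homo = H.refl
        }
      ; -‿homo = λ _ → H.refl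
      }
    ; injective = equal
    }

module E = CommutativeRing exprRing

≈⇒≃ : ∀ e f → e ≈ f → e ≃ f
≈⇒≃ e f p = equal (x∙y⁻¹≈ε⇒x≈y ⟦ e ⟧ ⟦ f ⟧ (isZero-sound 11 _ (Equivalence.from T-≡ p)))
  where open RingProperties (CommutativeRing.ring (commutativeRingP 11)) using (x∙y⁻¹≈ε⇒x≈y)

≃⇒≈ : ∀ e f → e ≃ f → e ≈ f
≃⇒≈ e f (equal p) = Equivalence.to T-≡ (isZero-complete 11 _ (x≈y⇒x∙y⁻¹≈ε p))
  where open RingProperties (CommutativeRing.ring (commutativeRingP 11)) using (x≈y⇒x∙y⁻¹≈ε)

-- The list is kept variable for induction; at `vertices` this is the right-hand side in `InI`.
combination : List Vertex → (Vertex → Expr) → Expr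
combination vs g = sumE vs (λ b → g b ⊗ gen b)

combination-⊕ : ∀ vs g h → (combination vs g ⊕ combination vs h) ≃ combination vs (λ b → g b ⊕ h b)
combination-⊕ []       g h = E.+-identityˡ _
combination-⊕ (v ∷ vs) g h = E.trans
  (interchange (g v ⊗ gen v) _ (h v ⊗ gen v) _)
  (E.+-cong (E.sym (E.distribʳ (gen v) (g v) (h v))) (combination-⊕ vs g h))
  where open CommutativeSemigroupProperties E.+-commutativeSemigroup using (interchange)

combination-⊗ : ∀ vs e g → (e ⊗ combination vs g) ≃ combination vs (λ b → e ⊗ g b)
combination-⊗ []       e g = E.zeroʳ e
combination-⊗ (v ∷ vs) e g = E.trans
  (E.distribˡ e (g v ⊗ gen v) _)
  (E.+-cong (E.sym (E.*-assoc e (g v) (gen v))) (combination-⊗ vs e g))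

InI-resp-≃ : ∀ e f → e ≃ f → InI e → InI f
InI-resp-≃ e f e≃f (g , p) = g , ≃⇒≈ f c (E.trans (E.sym e≃f) (≈⇒≃ e c p))
  where c = combination vertices g

InI-0 : InI (con 0ℚ)
InI-0 = (λ _ → con 0ℚ) , refl

InI-⊕ : ∀ e f → InI e → InI f → InI (e ⊕ f)
InI-⊕ e f (g , p) (h , q) = (λ b → g b ⊕ h b) ,
  ≃⇒≈ (e ⊕ f) (combination vertices (λ b → g b ⊕ h b))
    (E.trans (E.+-cong (≈⇒≃ e (combination vertices g) p) (≈⇒≃ f (combination vertices h) q))
             (combination-⊕ vertices g h))

InI-⊗ : ∀ e f → InI f → InI (e ⊗ f)
InI-⊗ e f (g , p) = (λ b → e ⊗ g b) ,
  ≃⇒≈ (e ⊗ f) (combination vertices (λ b → e ⊗ g b))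
    (E.trans (E.*-congˡ (≈⇒≃ f (combination vertices g) p)) (combination-⊗ vertices e g))

InI-isIdeal : IsIdeal exprRing InI
InI-isIdeal = record
  { I-resp-≈ = λ {e} {f} → InI-resp-≃ e f
  ; I-0      = InI-0
  ; I-+      = λ {e} {f} → InI-⊕ e f
  ; I-*      = λ e {f} → InI-⊗ e f
  }

-- The quotient by 𝓘 and its integer constants

open Quotient exprRing InI InI-isIdeal using (_∼_; congruent; ≈⇒∼) renaming (commutativeRing to hookSpace)

module HS = CommutativeRing hookSpace

-- Built with denominator 1 directly, this avoids gcd normalisation for a variable `i`. At 0, 1, 2
-- and 7 it agrees by computation with the constants in `F`.
fromℤ : ℤ → ℚ
fromℤ i = mkℚ i 0 (Coprimality.sym (Coprimality.1-coprimeTo ℤ.∣ i ∣))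

-- Rational addition normalises by a gcd; among unnormalised rationals the claim is an integer
-- identity obtained by cross multiplication.
fromℤ-+ : ∀ i j → fromℤ (i ℤ.+ j) ≡ fromℤ i +ℚ fromℤ j
fromℤ-+ i j = ℚ.toℚᵘ-injective
  (ℚᵘ.≃-trans (*≡* (lemma i j)) (ℚᵘ.≃-sym (ℚ.toℚᵘ-homo-+ (fromℤ i) (fromℤ j))))
  where
  lemma : ∀ i j → (i ℤ.+ j) ℤ.* + 1 ≡ (i ℤ.* + 1 ℤ.+ j ℤ.* + 1) ℤ.* + 1
  lemma = solve-∀

fromℤ-* : ∀ i j → fromℤ (i ℤ.* j) ≡ fromℤ i *ℚ fromℤ j
fromℤ-* i j = ℚ.toℚᵘ-injective
  (ℚᵘ.≃-trans (*≡* refl) (ℚᵘ.≃-sym (ℚ.toℚᵘ-homo-* (fromℤ i) (fromℤ j))))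

fromℤ-neg : ∀ i → fromℤ (ℤ.- i) ≡ -ℚ (fromℤ i)
fromℤ-neg i = ℚ.toℚᵘ-injective
  (ℚᵘ.≃-trans (*≡* refl) (ℚᵘ.≃-sym (ℚ.toℚᵘ-homo‿- (fromℤ i))))

κ : ℤ → Expr
κ = con ∘ fromℤ

κ-morphism : ℤ-rawRing -Raw-AlmostCommutative⟶ fromCommutativeRing hookSpace
κ-morphism = record
  { ⟦_⟧    = κ
  ; +-homo = λ i j → HS.trans (HS.reflexive (cong con (fromℤ-+ i j))) (≈⇒∼ (equal (cstP-+ 11 (fromℤ i) (fromℤ j))))
  ; *-homo = λ i j → HS.trans (HS.reflexive (cong con (fromℤ-* i j))) (≈⇒∼ (equal (cstP-* 11 (fromℤ i) (fromℤ j))))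
  ; -‿homo = λ i → HS.trans (HS.reflexive (cong con (fromℤ-neg i))) (≈⇒∼ (equal (cstP-neg 11 (fromℤ i))))
  ; 0-homo = HS.refl
  ; 1-homo = HS.refl
  }

-- Invariance of `F` in the hook space

open PetersenIdentity using (stanleySum-cong; stanleySum-even)
open StanleySum _⊕_ _⊗_ ⊖_ κ using (stanleySum)

½ℓ : Vertex → Expr
½ℓ v = con ½ ⊗ var (ℓ v)

½β : Expr
½β = con ½ ⊗ var β

½⊗⊖ : ∀ e → (con ½ ⊗ ⊖ e) ∼ (⊖ (con ½ ⊗ e))
½⊗⊖ e = HS.sym (-‿distribʳ-* (con ½) e)
  where open RingProperties HS.ring using (-‿distribʳ-*)

u⁺-split : ∀ v → u⁺ v ∼ (½ℓ v ⊕ ½β)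
u⁺-split v = HS.distribˡ (con ½) (var (ℓ v)) (var β)

u⁻-split : ∀ v → u⁻ v ∼ (½ℓ v ⊕ ⊖ ½β)
u⁻-split v = HS.trans (HS.distribˡ (con ½) (var (ℓ v)) (⊖ var β)) (HS.+-congˡ (½⊗⊖ (var β)))

Cu⁺-split : ∀ v → C (u⁺ v) ∼ (⊖ ½ℓ v ⊕ ½β)
Cu⁺-split v = HS.trans (HS.distribˡ (con ½) (⊖ var (ℓ v)) (var β)) (HS.+-congʳ (½⊗⊖ (var (ℓ v))))

Cu⁻-split : ∀ v → C (u⁻ v) ∼ (⊖ ½ℓ v ⊕ ⊖ ½β)
Cu⁻-split v = HS.trans (HS.distribˡ (con ½) (⊖ var (ℓ v)) (⊖ var β))
  (HS.+-cong (½⊗⊖ (var (ℓ v))) (½⊗⊖ (var β)))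

-- Both sides unfold to the same closed expression; the pattern-matching lambdas over `edges` reduce
-- on concrete pairs.
F≡stanleySum : F ≡ stanleySum u⁺ u⁻
F≡stanleySum = refl

-- `C` fixes constants and commutes with every operation by definition, so once the folds are
-- unfolded it acts only on the factors.
CF≡stanleySum : C F ≡ stanleySum (C ∘ u⁺) (C ∘ u⁻)
CF≡stanleySum = refl

-- The coefficient -½ cancels the term -ℓ_b that gen contributes at the
-- outer neighbour of the inner vertex b.
½ℓ-c3 : ½ℓ c3 ∼ ((½ℓ c4 ⊕ ⊖ ½ℓ c2) ⊕ ⊖ ½ℓ c5)
½ℓ-c3 = congruent ((λ b → if b == c4 then con -½ else con 0ℚ) , refl)

½ℓ-a3 : ½ℓ a3 ∼ ((½ℓ c2 ⊕ ⊖ ½ℓ c4) ⊕ ⊖ ½ℓ b3~)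
½ℓ-a3 = congruent ((λ b → if b == c2 then con -½ else con 0ℚ) , refl)

½ℓ-b2 : ½ℓ b2 ∼ ((½ℓ b3~ ⊕ ⊖ ½ℓ c2) ⊕ ⊖ ½ℓ a1)
½ℓ-b2 = congruent ((λ b → if b == b3~ then con -½ else con 0ℚ) , refl)

½ℓ-a2 : ½ℓ a2 ∼ ((½ℓ a1 ⊕ ⊖ ½ℓ b3~) ⊕ ⊖ ½ℓ c5)
½ℓ-a2 = congruent ((λ b → if b == a1 then con -½ else con 0ℚ) , refl)

½ℓ-b1 : ½ℓ b1 ∼ ((½ℓ c5 ⊕ ⊖ ½ℓ a1) ⊕ ⊖ ½ℓ c4)
½ℓ-b1 = congruent ((λ b → if b == c5 then con -½ else con 0ℚ) , refl)

stanleySum-C : stanleySum (C ∘ u⁺) (C ∘ u⁻) ∼ stanleySum u⁺ u⁻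
stanleySum-C = begin
  stanleySum (C ∘ u⁺) (C ∘ u⁻)
    ≈⟨ stanleySum-cong hookSpace κ-morphism (C ∘ u⁺) (λ v → ⊖ ½ℓ v ⊕ ½β) (C ∘ u⁻) (λ v → ⊖ ½ℓ v ⊕ ⊖ ½β)
         Cu⁺-split Cu⁻-split ⟩
  stanleySum (λ v → ⊖ ½ℓ v ⊕ ½β) (λ v → ⊖ ½ℓ v ⊕ ⊖ ½β)
    ≈⟨ stanleySum-even hookSpace κ-morphism ½ℓ ½β ½ℓ-c3 ½ℓ-a3 ½ℓ-b2 ½ℓ-a2 ½ℓ-b1 ⟩
  stanleySum (λ v → ½ℓ v ⊕ ½β) (λ v → ½ℓ v ⊕ ⊖ ½β)
    ≈⟨ stanleySum-cong hookSpace κ-morphism u⁺ (λ v → ½ℓ v ⊕ ½β) u⁻ (λ v → ½ℓ v ⊕ ⊖ ½β)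
         u⁺-split u⁻-split ⟨
  stanleySum u⁺ u⁻ ∎
  where open SetoidReasoning HS.setoid

∼⇒InI : ∀ {e f} → e ∼ f → InI (e ⊕ ⊖ f)
∼⇒InI (congruent e-f∈I) = e-f∈I

mainTheorem1 : InI (C F ⊕ ⊖ F)
mainTheorem1 = ∼⇒InI (subst₂ _∼_ (sym CF≡stanleySum) (sym F≡stanleySum) stanleySum-C)
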